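{- Let $t$ be a positive integer and let $C_n$ be the cycle on $n$ vertices ($n\ge 3$). Then $$c\chi_2^1(C_n)=\begin{cases}4,& \text{if } n>3,\\ 5,&\text{if } n=3,\end{cases}\qquad\text{and}\qquad c\chi_2^t(C_n)=\begin{cases}2,&\text{if } t\ge 2\text{ and } n \text{ is even},\\ 3,&\text{if } t\ge 2\text{ and } n\text{ is odd}.\end{cases}$$
   Context: Graphs are finite, undirected and simple. For a positive integer $k$ and $i,j\in\{0,1,\dots,k-1\}$, the circular distance is $|i-j|_k=\min\{|i-j|,\,k-|i-j|\}$. For a nonnegative integer $t$, a $(\frac{k}{2},t)^*$-coloring of a graph $G$ is a mapping $f:V(G)\to\{0,1,\dots,k-1\}$ such that adjacent vertices receive different integers and, for each vertex $u$, the number of neighbors $v$ of $u$ with $|f(u)-f(v)|_k=1$ is at most $t$. $G$ is $(\frac{k}{2},t)^*$-colorable if it has such a coloring. (The symbol $\frac{k}{2}$ is formal notation recording the pair $(k,2)$, not a reduced fraction.) The $t$-relaxed 2-distant circular chromatic number $c\chi_2^t(G)$ is the minimum positive integer $k$ such that $G$ is $(\frac{k}{2},t)^*$-colorable. -}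

module Defs where

open import Data.Fin.Base using (Fin; toℕ)
open import Data.List.Base using (length; filter; allFin)
open import Data.Nat.Base using (ℕ; suc; _∸_; _≤_; _⊓_; ∣_-_∣; s≤s)
open import Data.Nat.Properties using (_≟_; 1+n≢n)
open import Data.Product.Base using (Σ-syntax; _×_; _,_)
open import Data.Sum.Base using (_⊎_; inj₁; inj₂; swap)
open import Level using (0ℓ)
open import Relation.Binary.Core using (Rel)
open import Relation.Binary.Definitions using (Decidable; Symmetric; Irreflexive)
open import Relation.Binary.PropositionalEquality using (_≡_; _≢_; refl; subst)
open import Relation.Nullary.Decidable using (_×-dec_; _⊎-dec_)

-- Finite simple graphs on the vertex set Fin n.  Decidability of adjacency is
-- what allows neighbours to be counted.
record Graph (n : ℕ) : Set₁ where
  field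
    Adj    : Rel (Fin n) 0ℓ
    adj?   : Decidable Adj
    symm   : Symmetric Adj
    irrefl : Irreflexive _≡_ Adj

-- |i - j|ₖ
circDist : (k : ℕ) → Fin k → Fin k → ℕ
circDist k i j = ∣ toℕ i - toℕ j ∣ ⊓ (k ∸ ∣ toℕ i - toℕ j ∣)

module _ {n : ℕ} (G : Graph n) where
  open Graph G

  distOneNeighbours : {k : ℕ} → (Fin n → Fin k) → Fin n → ℕ
  distOneNeighbours {k} f u =
    length (filter (λ v → adj? u v ×-dec (circDist k (f u) (f v) ≟ 1)) (allFin n))

  -- f is a (k/2 , t)*-coloring of G
  IsColoring : (k t : ℕ) → (Fin n → Fin k) → Set
  IsColoring k t f = (∀ u v → Adj u v → f u ≢ f v)
                   × (∀ u → distOneNeighbours f u ≤ t)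

  Colorable : (k t : ℕ) → Set
  Colorable k t = Σ[ f ∈ (Fin n → Fin k) ] IsColoring k t f

IsMinimumPositive : (ℕ → Set) → ℕ → Set
IsMinimumPositive P k = (1 ≤ k × P k) × (∀ m → 1 ≤ m → P m → k ≤ m)

-- cχ₂[ t ] G ≐ k reads cχ₂ᵗ(G) = k: the minimum is given as a relation, which
-- determines k uniquely.
cχ₂[_]_≐_ : ℕ → {n : ℕ} → Graph n → ℕ → Set
cχ₂[ t ] G ≐ k = IsMinimumPositive (λ m → Colorable G m t) k

-- The arcs 0 → 1 → ⋯ → n-1 → 0; their symmetrisation is the cycle Cₙ.
Next : (n : ℕ) → Rel (Fin n) 0ℓ
Next n i j = suc (toℕ i) ≡ toℕ j ⊎ (suc (toℕ i) ≡ n × toℕ j ≡ 0)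

next? : (n : ℕ) → Decidable (Next n)
next? n i j = (suc (toℕ i) ≟ toℕ j) ⊎-dec ((suc (toℕ i) ≟ n) ×-dec (toℕ j ≟ 0))

next-irrefl : {n : ℕ} → 3 ≤ n → Irreflexive _≡_ (Next n)
next-irrefl _ refl (inj₁ 1+i≡i) = 1+n≢n 1+i≡i
next-irrefl {n} 3≤n {i} refl (inj₂ (1+i≡n , i≡0))
  with subst (λ x → suc x ≡ n) i≡0 1+i≡n
next-irrefl (s≤s ()) refl (inj₂ _) | refl

cycle : (n : ℕ) → 3 ≤ n → Graph n
cycle n 3≤n = record
  { Adj    = λ i j → Next n i j ⊎ Next n j i
  ; adj?   = λ i j → next? n i j ⊎-dec next? n j i
  ; symm   = swap
  ; irrefl = λ { refl (inj₁ e) → next-irrefl 3≤n refl e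
               ; refl (inj₂ e) → next-irrefl 3≤n refl e }
  }

{-# OPTIONS --safe #-}
-- Every vertex of a cycle has two neighbours, so the condition for t ≥ 2 is
-- vacuous and the usual chromatic number remains.  For t = 1, any two distinct
-- colours out of at most three are at distance 1, which forces k ≥ 4; with
-- k = 4, alternating 0,2 handles even cycles, and for odd n ≥ 5 the colouring
-- 0,1,3,0,2,0,2,… has only the two disjoint edges 01 and 23 of the cycle at
-- distance 1.  On the triangle every injective 4-colouring has a vertex at
-- distance 1 from both others.
module Submission where

open import Data.Fin.Base using (Fin; zero; suc; toℕ; fromℕ; inject₁)
import Data.Fin.Properties as Fin
open import Data.Fin.Properties using (toℕ-injective; toℕ<n; toℕ-fromℕ; toℕ-inject₁; injective⇒≤; all?)
open import Data.Fin.Patterns using (0F; 1F; 2F; 3F)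
open import Data.List.Base using (List; []; _∷_; length; lookup; filter; allFin)
open import Data.List.Membership.Propositional using (_∈_)
open import Data.List.Membership.Propositional.Properties using (∈-lookup; ∈-filter⁺; ∈-filter⁻; ∈-allFin)
import Data.List.Relation.Unary.All as All
open import Data.List.Relation.Unary.AllPairs using (_∷_)
open import Data.List.Relation.Unary.Any using (here)
open import Data.List.Relation.Unary.Unique.Propositional using (Unique)
open import Data.List.Relation.Unary.Unique.Propositional.Properties using (filter⁺; allFin⁺)
open import Data.Nat.Base using (ℕ; zero; suc; _*_; _∸_; _⊓_; _≤_; _<_; z≤n; s≤s; s≤s⁻¹)
open import Data.Nat.Divisibility using (_∣_; divides)
open import Data.Nat.Properties using (_≟_; _≤?_; ≤-trans; <-irrefl; ≮⇒≥; m≤n⇒m<n∨m≡n; suc-injective; ∣-∣-comm)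
open import Data.Product.Base using (_×_; _,_; proj₁; proj₂; ∃-syntax)
open import Data.Sum.Base using (_⊎_; inj₁; inj₂; [_,_]; swap)
open import Function.Base using (_∘_)
open import Level using (0ℓ)
open import Relation.Binary.Core using (Rel)
open import Relation.Binary.Definitions using (Symmetric)
open import Relation.Binary.PropositionalEquality using (_≡_; _≢_; refl; sym; trans; cong; subst; ≢-sym)
open import Relation.Nullary.Decidable using (Dec; from-yes; _×-dec_; _⊎-dec_; _→-dec_; ¬?)
open import Relation.Nullary.Negation using (¬_; contradiction)
open import Relation.Unary using (Pred; Decidable)
open import Defs

-- Counting by filtering.

lookup-injective : ∀ {A : Set} {xs : List A} → Unique xs →
                   ∀ {i j} → lookup xs i ≡ lookup xs j → i ≡ j
lookup-injective (_  ∷ _) {zero}  {zero}  _  = refl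
lookup-injective (x∉ ∷ _) {zero}  {suc j} eq = contradiction eq (All.lookup x∉ (∈-lookup j))
lookup-injective (x∉ ∷ _) {suc i} {zero}  eq = contradiction (sym eq) (All.lookup x∉ (∈-lookup i))
lookup-injective (_  ∷ u) {suc i} {suc j} eq = cong suc (lookup-injective u eq)

module _ {n : ℕ} {P : Pred (Fin n) 0ℓ} (P? : Decidable P) where

  -- The filtered list has no repetitions, so `lookup` followed by `code` injects its positions into
  -- `Fin m`.
  count≤ : ∀ {m} (code : ∀ v → P v → Fin m) →
           (∀ {v w} (p : P v) (q : P w) → code v p ≡ code w q → v ≡ w) →
           length (filter P? (allFin n)) ≤ m
  count≤ code code-injective =
    injective⇒≤ {f = λ i → code _ (satisfies i)}
      (lookup-injective (filter⁺ P? (allFin⁺ n)) ∘ code-injective _ _)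
    where
    satisfies : ∀ i → P (lookup (filter P? (allFin n)) i)
    satisfies i = proj₂ (∈-filter⁻ P? {xs = allFin n} (∈-lookup i))

  count≤1⇒unique : length (filter P? (allFin n)) ≤ 1 → ∀ {v w} → P v → P w → v ≡ w
  count≤1⇒unique ≤1 p q = short ≤1 (∈-filter⁺ P? (∈-allFin _) p) (∈-filter⁺ P? (∈-allFin _) q)
    where
    short : ∀ {xs : List (Fin n)} {v w} → length xs ≤ 1 → v ∈ xs → w ∈ xs → v ≡ w
    short {_ ∷ []}    _        (here refl) (here refl) = refl
    short {_ ∷ _ ∷ _} (s≤s ()) _           _

-- Circular distance and neighbours at distance 1.

circDist-sym : ∀ {k} (i j : Fin k) → circDist k i j ≡ circDist k j i
circDist-sym {k} i j = cong (λ d → d ⊓ (k ∸ d)) (∣-∣-comm (toℕ i) (toℕ j))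

Far : ∀ {k} → Rel (Fin k) 0ℓ
Far {k} x y = circDist k x y ≢ 1

Far-sym : ∀ {k} → Symmetric (Far {k})
Far-sym {k} {x} {y} xy yx = xy (trans (circDist-sym x y) yx)

module _ {n k : ℕ} (G : Graph n) (f : Fin n → Fin k) (u : Fin n) where

  open Graph G

  DistOneNeighbour : Pred (Fin n) 0ℓ
  DistOneNeighbour v = Adj u v × circDist k (f u) (f v) ≡ 1

  distOneNeighbour? : Decidable DistOneNeighbour
  distOneNeighbour? v = adj? u v ×-dec circDist k (f u) (f v) ≟ 1

  distOneNeighbours≤ : ∀ {m} (code : ∀ v → DistOneNeighbour v → Fin m) →
    (∀ {v w} (p : DistOneNeighbour v) (q : DistOneNeighbour w) → code v p ≡ code w q → v ≡ w) →
    distOneNeighbours G f u ≤ m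
  distOneNeighbours≤ = count≤ distOneNeighbour?

  distOneNeighbour-unique : distOneNeighbours G f u ≤ 1 →
    ∀ {v w} → DistOneNeighbour v → DistOneNeighbour w → v ≡ w
  distOneNeighbour-unique = count≤1⇒unique distOneNeighbour?

isColoring? : ∀ {n} (G : Graph n) k t f → Dec (IsColoring G k t f)
isColoring? G k t f =
  all? (λ u → all? λ v → Graph.adj? G u v →-dec ¬? (f u Fin.≟ f v))
    ×-dec all? (λ u → distOneNeighbours G f u ≤? t)

-- Adjacency in the cycle.

next-functional : ∀ {n u v w} → Next n u v → Next n u w → v ≡ w
next-functional (inj₁ e) (inj₁ e′) = toℕ-injective (trans (sym e) e′)
-- Here `v` would have index `n`, one beyond the last vertex.
next-functional {v = v} (inj₁ e) (inj₂ (e′ , _)) = contradiction (toℕ<n v) (<-irrefl (trans (sym e) e′))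
next-functional {w = w} (inj₂ (e , _)) (inj₁ e′) = contradiction (toℕ<n w) (<-irrefl (trans (sym e′) e))
next-functional (inj₂ (_ , e)) (inj₂ (_ , e′)) = toℕ-injective (trans e (sym e′))

next-injective : ∀ {n u v w} → Next n u w → Next n v w → u ≡ v
next-injective (inj₁ e) (inj₁ e′) = toℕ-injective (suc-injective (trans e (sym e′)))
next-injective (inj₁ e) (inj₂ (_ , e′)) with () ← trans e e′
next-injective (inj₂ (_ , e)) (inj₁ e′) with () ← trans e′ e
next-injective (inj₂ (e , _)) (inj₂ (e′ , _)) = toℕ-injective (suc-injective (trans e (sym e′)))

module _ {n : ℕ} (3≤n : 3 ≤ n) where

  open Graph (cycle n 3≤n)

  -- A neighbour is determined by its direction, successor or predecessor, which serves as a code in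
  -- `Fin 2`.
  distOneNeighbours≤2 : ∀ {k} (f : Fin n → Fin k) u → distOneNeighbours (cycle n 3≤n) f u ≤ 2
  distOneNeighbours≤2 f u = distOneNeighbours≤ (cycle n 3≤n) f u side side-injective
    where
    side : ∀ v → DistOneNeighbour (cycle n 3≤n) f u v → Fin 2
    side _ (inj₁ _ , _) = 0F
    side _ (inj₂ _ , _) = 1F

    side-injective : ∀ {v w} p q → side v p ≡ side w q → v ≡ w
    side-injective (inj₁ e , _) (inj₁ e′ , _) _ = next-functional e e′
    side-injective (inj₂ e , _) (inj₂ e′ , _) _ = next-injective e e′

  -- Up to orientation every edge is a step from `i` to `suc i` or the closing edge from the last
  -- vertex to 0. Working over ℕ allows colourings to be defined by recursion on the index.
  adj-lift : (R : Rel ℕ 0ℓ) → Symmetric R →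
             (∀ i → R i (suc i)) → (∀ i → suc i ≡ n → R i 0) →
             ∀ u v → Adj u v → R (toℕ u) (toℕ v)
  adj-lift R R-sym step close u v = [ next , (λ e → R-sym (next e)) ]
    where
    next : ∀ {u v} → Next n u v → R (toℕ u) (toℕ v)
    next {u} (inj₁ e)       = subst (R (toℕ u)) e (step (toℕ u))
    next {u} (inj₂ (e , z)) = subst (R (toℕ u)) (sym z) (close (toℕ u) e)

  proper : ∀ {k} (c : ℕ → Fin k) →
           (∀ i → c i ≢ c (suc i)) → (∀ i → suc i ≡ n → c i ≢ c 0) →
           ∀ u v → Adj u v → c (toℕ u) ≢ c (toℕ v)
  proper c = adj-lift (λ i j → c i ≢ c j) ≢-sym

-- Alternating sequences and parity.

alternate : ∀ {A : Set} → A → A → ℕ → A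
alternate a b zero    = a
alternate a b (suc i) = alternate b a i

module _ {A : Set} where

  alternate-step : (R : Rel A 0ℓ) → Symmetric R → ∀ {a b} → R a b →
                   ∀ i → R (alternate a b i) (alternate a b (suc i))
  alternate-step R R-sym r zero    = r
  alternate-step R R-sym r (suc i) = alternate-step R R-sym (R-sym r) i

  alternate-all : (P : Pred A 0ℓ) → ∀ {a b} → P a → P b → ∀ i → P (alternate a b i)
  alternate-all P pa pb zero    = pa
  alternate-all P pa pb (suc i) = alternate-all P pb pa i

  alternate-even : ∀ {a b : A} q → alternate a b (q * 2) ≡ a
  alternate-even zero    = refl
  alternate-even (suc q) = alternate-even q

  alternate-last : ∀ {a b : A} {i} q → suc i ≡ q * 2 → alternate a b i ≡ b
  alternate-last (suc q) refl = alternate-even q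

parity : ∀ n → (∃[ q ] n ≡ q * 2) ⊎ (∃[ q ] n ≡ suc (q * 2))
parity zero = inj₁ (0 , refl)
parity (suc n) with parity n
... | inj₁ (q , refl) = inj₂ (q , refl)
... | inj₂ (q , refl) = inj₁ (suc q , refl)

odd : ∀ {n} → ¬ (2 ∣ n) → ∃[ q ] n ≡ suc (q * 2)
odd {n} ¬2∣n with parity n
... | inj₁ (q , eq) = contradiction (divides q eq) ¬2∣n
... | inj₂ q        = q

even-alternate-proper : ∀ {n k} (3≤n : 3 ≤ n) q → n ≡ q * 2 → {a b : Fin k} → a ≢ b →
  ∀ u v → Graph.Adj (cycle n 3≤n) u v → alternate a b (toℕ u) ≢ alternate a b (toℕ v)
even-alternate-proper 3≤n q refl {a} {b} a≢b =
  proper 3≤n (alternate a b) (alternate-step _≢_ ≢-sym a≢b)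
    -- The closing edge joins the last index, which is odd and coloured `b`, to 0, coloured `a`.
    (λ i e → subst (_≢ a) (sym (alternate-last q e)) (≢-sym a≢b))

-- Colourings for the upper bounds.

even-2-colorable : ∀ {n t} (3≤n : 3 ≤ n) → 2 ≤ t → 2 ∣ n → Colorable (cycle n 3≤n) 2 t
even-2-colorable 3≤n 2≤t (divides q eq) =
  c , even-alternate-proper 3≤n q eq (λ ()) ,
  λ u → ≤-trans (distOneNeighbours≤2 3≤n c u) 2≤t
  where
  c : Fin _ → Fin 2
  c = alternate 0F 1F ∘ toℕ

-- Vertex 0 gets the colour 2 alone; the remaining path alternates 0 and 1, so both its ends differ
-- from vertex 0 whatever the parity of `n`.
3-colorable : ∀ {n t} (3≤n : 3 ≤ n) → 2 ≤ t → Colorable (cycle n 3≤n) 3 t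
3-colorable {n} 3≤n 2≤t =
  c ∘ toℕ , proper 3≤n c step close , λ u → ≤-trans (distOneNeighbours≤2 3≤n (c ∘ toℕ) u) 2≤t
  where
  c : ℕ → Fin 3
  c zero    = 2F
  c (suc i) = alternate 0F 1F i

  step : ∀ i → c i ≢ c (suc i)
  step zero    ()
  step (suc i) = alternate-step _≢_ ≢-sym (λ ()) i

  close : ∀ i → suc i ≡ n → c i ≢ c 0
  close zero    eq   = contradiction (subst (3 ≤_) (sym eq) 3≤n) λ { (s≤s ()) }
  close (suc i) _    = alternate-all (_≢ 2F) (λ ()) (λ ()) i

even-4-colorable : ∀ {n} (3≤n : 3 ≤ n) q → n ≡ q * 2 → Colorable (cycle n 3≤n) 4 1
even-4-colorable 3≤n q refl =
  c ∘ toℕ , even-alternate-proper 3≤n q refl (λ ()) ,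
  -- The colours 0 and 2 are at distance 2 modulo 4, so no neighbour is counted: the code lands in
  -- `Fin 0`.
  λ u → ≤-trans (distOneNeighbours≤ (cycle _ 3≤n) (c ∘ toℕ) u
                   (λ v (a , d) → contradiction d (far u v a))
                   (λ {v} (a , d) → contradiction d (far u v a)))
                 (z≤n {1})
  where
  c : ℕ → Fin 4
  c = alternate 0F 2F

  far : ∀ u v → Graph.Adj (cycle _ 3≤n) u v → Far (c (toℕ u)) (c (toℕ v))
  far = adj-lift 3≤n (λ i j → Far (c i) (c j)) (λ {i} → Far-sym {x = c i})
    (alternate-step Far (λ {x} → Far-sym {x = x}) (λ ()))
    (λ i e → subst (λ x → Far x 0F) (sym (alternate-last q e)) λ ())

odd-4-colorable : ∀ {n} (3≤n : 3 ≤ n) → 3 < n → ∀ q → n ≡ suc (q * 2) → Colorable (cycle n 3≤n) 4 1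
odd-4-colorable 3≤n (s≤s (s≤s (s≤s ()))) 1 refl
odd-4-colorable {n} 3≤n 3<n (suc (suc q)) refl =
  c ∘ toℕ , proper 3≤n c step close ,
  -- A constant code is injective because every counted neighbour has index `mate (toℕ u)`.
  λ u → distOneNeighbours≤ (cycle n 3≤n) (c ∘ toℕ) u (λ _ _ → zero)
    λ {v} {w} (a , d) (a′ , d′) _ →
      toℕ-injective (trans (proj₁ (mates u v a d)) (sym (proj₁ (mates u w a′ d′))))
  where
  c : ℕ → Fin 4
  c 0 = 0F
  c 1 = 1F
  c 2 = 3F
  c (suc (suc (suc i))) = alternate 0F 2F i

  -- Exchanges the ends of the edges 01 and 23. The last clause is meant for 3; larger indices lie
  -- on no edge at distance 1.
  mate : ℕ → ℕ
  mate 0 = 1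
  mate 1 = 0
  mate 2 = 3
  mate _ = 2

  -- Now `n` is `5 + q * 2`, so the last vertex sits at the odd position `1 + q * 2` of the
  -- alternating tail.
  c-last : ∀ {i} → suc i ≡ n → c i ≡ 2F
  c-last refl = alternate-even q

  step : ∀ i → c i ≢ c (suc i)
  step 0 ()
  step 1 ()
  step 2 ()
  step (suc (suc (suc i))) = alternate-step _≢_ ≢-sym (λ ()) i

  close : ∀ i → suc i ≡ n → c i ≢ 0F
  close i e eq with () ← trans (sym (c-last e)) eq

  -- Both equations are recorded to make the relation symmetric, as `adj-lift` requires.
  Mates : Rel ℕ 0ℓ
  Mates i j = circDist 4 (c i) (c j) ≡ 1 → j ≡ mate i × i ≡ mate j

  Mates-sym : Symmetric Mates
  Mates-sym {i} {j} m d with m (trans (circDist-sym (c i) (c j)) d)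
  ... | p , q = q , p

  mates-step : ∀ i → Mates i (suc i)
  mates-step 0 _ = refl , refl
  mates-step 1 ()
  mates-step 2 _ = refl , refl
  mates-step (suc (suc (suc i))) d =
    contradiction d (alternate-step Far (λ {x} → Far-sym {x = x}) (λ ()) i)

  mates-close : ∀ i → suc i ≡ n → Mates i 0
  mates-close i e d with () ← trans (cong (λ x → circDist 4 x 0F) (sym (c-last e))) d

  mates : ∀ u v → Graph.Adj (cycle n 3≤n) u v → Mates (toℕ u) (toℕ v)
  mates = adj-lift 3≤n Mates (λ {i} → Mates-sym {i}) mates-step mates-close

4-colorable : ∀ {n} (3≤n : 3 ≤ n) → 3 < n → Colorable (cycle n 3≤n) 4 1
4-colorable {n} 3≤n 3<n with parity n
... | inj₁ (q , eq) = even-4-colorable 3≤n q eq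
... | inj₂ (q , eq) = odd-4-colorable 3≤n 3<n q eq

-- Among the colours 0, 1, 3 modulo 5 only 0 and 1 are at distance 1; the pairs 1, 3 and 0, 3 are at
-- distance 2.
triangle-5-colorable : (3≤3 : 3 ≤ 3) → Colorable (cycle 3 3≤3) 5 1
triangle-5-colorable 3≤3 = f , from-yes (isColoring? (cycle 3 3≤3) 5 1 f)
  where
  f : Fin 3 → Fin 5
  f 0F = 0F
  f 1F = 1F
  f 2F = 3F

-- Lower bounds.

colorable⇒2≤ : ∀ {n t} (3≤n : 3 ≤ n) → ∀ m → Colorable (cycle n 3≤n) m t → 2 ≤ m
colorable⇒2≤ (s≤s (s≤s (s≤s _))) 0 (f , _) with () ← f 0F
colorable⇒2≤ (s≤s (s≤s (s≤s _))) 1 (f , distinct , _) =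
  contradiction (Fin1-prop (f 0F) (f 1F)) (distinct 0F 1F (inj₁ (inj₁ refl)))
  where
  Fin1-prop : ∀ (x y : Fin 1) → x ≡ y
  Fin1-prop 0F 0F = refl
colorable⇒2≤ _ (suc (suc _)) _ = s≤s (s≤s z≤n)

Fin2-third : ∀ (x y z : Fin 2) → x ≢ y → y ≢ z → x ≡ z
Fin2-third = from-yes (all? λ (x : Fin 2) → all? λ y → all? λ z →
  ¬? (x Fin.≟ y) →-dec ¬? (y Fin.≟ z) →-dec x Fin.≟ z)

-- With two colours, two consecutive steps return to the same colour. The induction descends to 0
-- through `u′` and `u″`, the vertices one and two places earlier.
even-vertices-monochromatic : ∀ {n} (f : Fin (suc n) → Fin 2) →
  (∀ u v → Next (suc n) u v → f u ≢ f v) →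
  ∀ q u → toℕ u ≡ q * 2 → f u ≡ f 0F
even-vertices-monochromatic f distinct zero    0F            _  = refl
even-vertices-monochromatic f distinct (suc q) (suc (suc u)) eq =
  trans (sym (Fin2-third _ _ _ (distinct u″ u′ u″→u′) (distinct u′ (suc (suc u)) u′→u)))
        (even-vertices-monochromatic f distinct q u″
          (trans toℕ-u″ (suc-injective (suc-injective eq))))
  where
  u′ = inject₁ (suc u)
  u″ = inject₁ (inject₁ u)

  toℕ-u″ : toℕ u″ ≡ toℕ u
  toℕ-u″ = trans (toℕ-inject₁ (inject₁ u)) (toℕ-inject₁ u)

  u″→u′ : Next _ u″ u′
  u″→u′ = inj₁ (cong suc (toℕ-inject₁ (inject₁ u)))

  u′→u : Next _ u′ (suc (suc u))
  u′→u = inj₁ (cong suc (toℕ-inject₁ (suc u)))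

-- The last vertex has the even index `q * 2`, hence the colour of vertex 0, to which it is
-- adjacent.
odd⇒¬2-colorable : ∀ {n t} (3≤n : 3 ≤ n) q → n ≡ suc (q * 2) → ¬ Colorable (cycle n 3≤n) 2 t
odd⇒¬2-colorable 3≤n q refl (f , distinct , _) =
  distinct (fromℕ (q * 2)) 0F
    (inj₁ (inj₂ (cong suc (toℕ-fromℕ (q * 2)) , refl)))
    (even-vertices-monochromatic f (λ u v → distinct u v ∘ inj₁)
      q (fromℕ (q * 2)) (toℕ-fromℕ (q * 2)))

odd-colorable⇒3≤ : ∀ {n t} (3≤n : 3 ≤ n) → ¬ (2 ∣ n) → ∀ m → Colorable (cycle n 3≤n) m t → 3 ≤ m
odd-colorable⇒3≤ 3≤n ¬2∣n m colorable with m≤n⇒m<n∨m≡n (colorable⇒2≤ 3≤n m colorable)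
... | inj₁ 3≤m  = 3≤m
... | inj₂ refl = contradiction colorable (let q , eq = odd ¬2∣n in odd⇒¬2-colorable 3≤n q eq)

distance-one? : ∀ m → Dec (∀ (x y : Fin m) → x ≢ y → circDist m x y ≡ 1)
distance-one? m = all? λ x → all? λ y → ¬? (x Fin.≟ y) →-dec circDist m x y ≟ 1

distance-one : ∀ {m} → m ≤ 3 → ∀ (x y : Fin m) → x ≢ y → circDist m x y ≡ 1
distance-one z≤n                   = from-yes (distance-one? 0)
distance-one (s≤s z≤n)             = from-yes (distance-one? 1)
distance-one (s≤s (s≤s z≤n))       = from-yes (distance-one? 2)
distance-one (s≤s (s≤s (s≤s z≤n))) = from-yes (distance-one? 3)

-- With fewer than four colours, vertices 0 and 2 would both be at distance 1 from their common
-- neighbour 1 and so would coincide. Vertex 1 is convenient because neither of its edges is the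
-- closing one.
1-colorable⇒4≤ : ∀ {n} (3≤n : 3 ≤ n) → ∀ m → Colorable (cycle n 3≤n) m 1 → 4 ≤ m
1-colorable⇒4≤ 3≤n@(s≤s (s≤s (s≤s _))) m (f , distinct , ≤1) = ≮⇒≥ λ m<4 →
  let d = λ v (a : Adj 1F v) → a , distance-one (s≤s⁻¹ m<4) (f 1F) (f v) (distinct 1F v a)
  in 0≢2 (distOneNeighbour-unique (cycle _ 3≤n) f 1F (≤1 1F) (d 0F (inj₂ (inj₁ refl))) (d 2F (inj₁ (inj₁ refl))))
  where
  open Graph (cycle _ 3≤n)

  0≢2 : ∀ {p} → _≢_ {A = Fin (suc (suc (suc p)))} 0F 2F
  0≢2 ()

-- Three distinct elements of ℤ/4 are consecutive, and the middle one is at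
-- distance 1 from the other two.
Fin4-middle : ∀ (x y z : Fin 4) → x ≢ y → y ≢ z → z ≢ x →
  (circDist 4 x y ≡ 1 × circDist 4 x z ≡ 1) ⊎
  (circDist 4 y x ≡ 1 × circDist 4 y z ≡ 1) ⊎
  (circDist 4 z x ≡ 1 × circDist 4 z y ≡ 1)
Fin4-middle = from-yes (all? λ x → all? λ y → all? λ z →
  ¬? (x Fin.≟ y) →-dec ¬? (y Fin.≟ z) →-dec ¬? (z Fin.≟ x) →-dec
  ((circDist 4 x y ≟ 1 ×-dec circDist 4 x z ≟ 1) ⊎-dec
   (circDist 4 y x ≟ 1 ×-dec circDist 4 y z ≟ 1) ⊎-dec
   (circDist 4 z x ≟ 1 ×-dec circDist 4 z y ≟ 1)))

-- Whichever vertex carries the middle colour, `unique` identifies the other two.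
triangle-¬4-colorable : (3≤3 : 3 ≤ 3) → ¬ Colorable (cycle 3 3≤3) 4 1
triangle-¬4-colorable 3≤3 (f , distinct , ≤1) =
  [ (λ (d , d′) → contradiction (unique 0F (0-1 , d) (swap 2-0 , d′)) λ ())
  , [ (λ (d , d′) → contradiction (unique 1F (swap 0-1 , d) (1-2 , d′)) λ ())
    , (λ (d , d′) → contradiction (unique 2F (2-0 , d) (swap 1-2 , d′)) λ ()) ] ]
  (Fin4-middle (f 0F) (f 1F) (f 2F) (distinct 0F 1F 0-1) (distinct 1F 2F 1-2) (distinct 2F 0F 2-0))
  where
  open Graph (cycle 3 3≤3)

  unique : ∀ u {v w} → DistOneNeighbour (cycle 3 3≤3) f u v →
           DistOneNeighbour (cycle 3 3≤3) f u w → v ≡ w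
  unique u = distOneNeighbour-unique (cycle 3 3≤3) f u (≤1 u)

  0-1 : Adj 0F 1F
  0-1 = inj₁ (inj₁ refl)

  1-2 : Adj 1F 2F
  1-2 = inj₁ (inj₁ refl)

  2-0 : Adj 2F 0F
  2-0 = inj₁ (inj₂ (refl , refl))

triangle-1-colorable⇒5≤ : (3≤3 : 3 ≤ 3) → ∀ m → Colorable (cycle 3 3≤3) m 1 → 5 ≤ m
triangle-1-colorable⇒5≤ 3≤3 m colorable with m≤n⇒m<n∨m≡n (1-colorable⇒4≤ 3≤3 m colorable)
... | inj₁ 5≤m  = 5≤m
... | inj₂ refl = contradiction colorable (triangle-¬4-colorable 3≤3)

theorem2p2 : (t n : ℕ) → 1 ≤ t → (3≤n : 3 ≤ n) →
    ((3 < n → cχ₂[ 1 ] cycle n 3≤n ≐ 4) × (n ≡ 3 → cχ₂[ 1 ] cycle n 3≤n ≐ 5)) ×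
    ((2 ≤ t × 2 ∣ n → cχ₂[ t ] cycle n 3≤n ≐ 2) × (2 ≤ t × ¬ (2 ∣ n) → cχ₂[ t ] cycle n 3≤n ≐ 3))
theorem2p2 t n _ 3≤n =
  ( (λ 3<n → (s≤s z≤n , 4-colorable 3≤n 3<n) , λ m _ → 1-colorable⇒4≤ 3≤n m)
  , (λ { refl → (s≤s z≤n , triangle-5-colorable 3≤n) , λ m _ → triangle-1-colorable⇒5≤ 3≤n m }) ) ,
  ( (λ (2≤t , 2∣n) → (s≤s z≤n , even-2-colorable 3≤n 2≤t 2∣n) , λ m _ → colorable⇒2≤ 3≤n m)
  , (λ (2≤t , ¬2∣n) → (s≤s z≤n , 3-colorable 3≤n 2≤t) , λ m _ → odd-colorable⇒3≤ 3≤n ¬2∣n m) )
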